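{- Let $\mathbf{F}$ be a Fraïssé structure in $L$ and let $\mathbf{F}^{*}$ be a Fraïssé precompact relational expansion of $\mathbf{F}$ in $L^{*}$. Let $G=\mathrm{Aut}(\mathbf{F})$ and $G^{*}=\mathrm{Aut}(\mathbf{F}^{*})\leq G$. Then the following are equivalent: (i) The pair $(G,G^{*})$ is relatively extremely amenable. (ii) The elements of $\mathrm{Age}(\mathbf{F}^{*})$ are rigid and the pair $(\mathrm{Age}(\mathbf{F}),\mathrm{Age}(\mathbf{F}^{*}))$ has the relative Ramsey property for embeddings.
   Context: $\mathbb{N}=\{0,1,2,\ldots\}$ and $[k]=\{0,\ldots,k-1\}$. $L$ is a countable first-order signature and $L^{*}=L\cup\{R_i : i\in I^{*}\}$, where $I^{*}$ is countable and each $R_i$ is a relation symbol not in $L$, of arity $\alpha(i)$. A Fraïssé structure is a countable (infinite), locally finite (finitely generated substructures are finite), ultrahomogeneous structure (every isomorphism between finite substructures extends to an automorphism). $\mathrm{Age}(\mathbf{F})$ is the class of finite structures that embed in $\mathbf{F}$. An expansion $\mathbf{F}^{*}$ of $\mathbf{F}$ in $L^{*}$ is an $L^{*}$-structure whose $L$-reduct is $\mathbf{F}$; "Fraïssé expansion" means $\mathbf{F}^{*}$ is itself a Fraïssé structure in $L^{*}$. It is precompact if every element of $\mathrm{Age}(\mathbf{F})$ has only finitely many expansions in $\mathrm{Age}(\mathbf{F}^{*})$. Both $\mathbf{F}$ and $\mathbf{F}^{*}$ have universe $\mathbb{N}$, so $G^{*}\leq G$ are closed subgroups of $S_\infty$,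 the group of permutations of $\mathbb{N}$ with the topology of pointwise convergence. A structure is rigid if its only automorphism is the identity. All topological spaces are Hausdorff. For topological groups $H\leq G$, the pair $(G,H)$ is relatively extremely amenable if every continuous action of $G$ on every (nonempty) compact space admits a point fixed by every element of $H$. A class $\mathcal{K}^{*}$ of $L^{*}$-structures is an expansion in $L^{*}$ of a class $\mathcal{K}$ of $L$-structures if every element of $\mathcal{K}^{*}$ is an expansion of an element of $\mathcal{K}$ and every element of $\mathcal{K}$ has an expansion in $\mathcal{K}^{*}$. For $\mathbf{B}^{*}\in\mathcal{K}^{*}$, $\mathbf{B}$ denotes its $L$-reduct. For $L$-structures, $\binom{\mathbf{B}}{\mathbf{A}}_{\mathrm{Emb}}$ denotes the set of embeddings of $\mathbf{A}$ into $\mathbf{B}$. If $\mathbf{B}^{*}$ is an expansion of $\mathbf{B}$ and $a\in\binom{\mathbf{B}}{\mathbf{A}}_{\mathrm{Emb}}$, the canonical expansion of $\mathbf{A}$ induced by $a$ is $(\mathbf{A},(R^{a}_i)_{i\in I^{*}})$, where $R^{a}_i(x_1,\ldots,x_{\alpha(i)})\Leftrightarrow R^{\mathbf{B}^{*}}_i(a(x_1),\ldots,a(x_{\alpha(i)}))$ for $i\in I^{*}$. Write $a\cong_{\mathbf{B}^{*}}a'$ if the canonical expansions of $\mathbf{A}$ induced by $a$ and $a'$ are equal (not only isomorphic). For $\mathcal{K}$ a class of finite $L$-structures and $\mathcal{K}^{*}$ an expansion of $\mathcal{K}$ in $L^{*}$, the pair $(\mathcal{K},\mathcal{K}^{*})$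 has the relative Ramsey property for embeddings if for every $k\in\mathbb{N}$, $\mathbf{A}\in\mathcal{K}$, $\mathbf{B}^{*}\in\mathcal{K}^{*}$, there exists $\mathbf{C}\in\mathcal{K}$ such that for every coloring $c:\binom{\mathbf{C}}{\mathbf{A}}_{\mathrm{Emb}}\to[k]$ there exists $b\in\binom{\mathbf{C}}{\mathbf{B}}_{\mathrm{Emb}}$ such that for all $a_0,a_1\in\binom{\mathbf{B}}{\mathbf{A}}_{\mathrm{Emb}}$, $a_0\cong_{\mathbf{B}^{*}}a_1$ implies $c(ba_0)=c(ba_1)$. -}

module Defs where

open import Algebra.Bundles using (Group)
open import Data.Fin.Base using (Fin)
import Data.Irrelevant as Irrelevant
open import Data.List.Base as List using (List)
open import Data.List.Membership.Propositional using () renaming (_∈_ to _∈ₗ_)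
open import Data.List.Relation.Unary.All as ListAll using (All)
import Data.List.Relation.Unary.All.Properties as ListAll
open import Data.List.Relation.Unary.Any using (Any)
open import Data.Nat.Base using (ℕ)
open import Data.Product.Base
  using (Σ-syntax; ∃₂; ∃-syntax; _×_; _,_; proj₂; uncurry)
open import Data.Product.Relation.Binary.Pointwise.NonDependent using (×-setoid)
open import Data.Refinement.Base using (Refinement; Refinement-syntax; value; _,_)
open import Data.Sum.Base using (_⊎_; inj₁; inj₂; [_,_]′)
open import Data.Unit.Polymorphic.Base using (tt)
open import Data.Vec.Base as Vec using (Vec; []; _∷_)
open import Data.Vec.Properties using (map-∘; map-cong; map-id)
open import Data.Vec.Relation.Unary.All as VecAll using ([]; _∷_)
open import Function.Base using (_∘_; id)
open import Function.Bundles
  using (Func; Inverse; _↔_; _↣_; _⇔_; _⟶ₛ_)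
open import Function.Construct.Composition using (_↔-∘_; _⇔-∘_)
open import Function.Construct.Identity using (↔-id; ⇔-id)
open import Function.Construct.Symmetry using (↔-sym; ⇔-sym)
open import Function.Definitions using (Injective)
open import Level using (Level; 0ℓ; suc; _⊔_)
open import Relation.Binary.Bundles using (Setoid)
open import Relation.Binary.Definitions using (_Respects_)
import Relation.Binary.PropositionalEquality as ≡
open import Relation.Binary.PropositionalEquality
  using (_≡_; refl; sym; trans; cong; subst; module ≡-Reasoning)
open import Relation.Nullary.Negation using (¬_)
open import Relation.Unary using (Pred; _∈_; _⊆_; _≐_; _∩_; _⊢_; _⊥_; _⟨×⟩_)
open import Relation.Unary.Polymorphic using (U)

private
  variable
    ℓ ℓ₁ ℓ₂ : Level

------------------------------------------------------------------------
-- Topology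

-- Sets are modelled by setoids, and a subset of X by a predicate at the
-- level of X, so that Pred Carrier ℓ plays the role of the power set.
-- Stating union-open for any W with the same elements as the union of 𝒰
-- makes openness depend only on the elements of a subset and lets 𝒰 be
-- an arbitrary set of opens.
record Topology (X : Setoid ℓ ℓ) : Set (suc (suc ℓ)) where
  open Setoid X using (Carrier; _≈_)
  field
    IsOpen            : Pred (Pred Carrier ℓ) (suc ℓ)
    open-respects     : ∀ {V} → IsOpen V → V Respects _≈_
    universe-open     : IsOpen U
    intersection-open : ∀ {V W} → IsOpen V → IsOpen W → IsOpen (V ∩ W)
    union-open        : (𝒰 : Pred (Pred Carrier ℓ) (suc ℓ)) → 𝒰 ⊆ IsOpen →
                        ∀ {W} → W ≐ (λ x → ∃[ V ] V ∈ 𝒰 × x ∈ V) → IsOpen W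

open Topology using (IsOpen)

Hausdorff : {X : Setoid ℓ ℓ} → Topology X → Set (suc ℓ)
Hausdorff {X = X} τ = ∀ x y → ¬ (x ≈ y) →
  ∃₂ λ V W → IsOpen τ V × IsOpen τ W × x ∈ V × y ∈ W × V ⊥ W
  where open Setoid X

Compact : {X : Setoid ℓ ℓ} → Topology X → Set (suc (suc ℓ))
Compact {ℓ = ℓ} {X = X} τ =
  (𝒰 : Pred (Pred Carrier ℓ) (suc ℓ)) → 𝒰 ⊆ IsOpen τ →
  (∀ x → ∃[ V ] V ∈ 𝒰 × x ∈ V) →
  ∃[ Vs ] All 𝒰 Vs × (∀ x → Any (x ∈_) Vs)
  where open Setoid X

Continuous : {X Y : Setoid ℓ ℓ} → Topology X → Topology Y →
             Pred (Setoid.Carrier X → Setoid.Carrier Y) (suc ℓ)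
Continuous τ σ f = ∀ V → IsOpen σ V → IsOpen τ (f ⊢ V)

infixr 2 _×ₜ_

_×ₜ_ : {X : Setoid ℓ₁ ℓ₁} {Y : Setoid ℓ₂ ℓ₂} →
       Topology X → Topology Y → Topology (×-setoid X Y)
_×ₜ_ {ℓ₁} {ℓ₂} {X} {Y} τ σ = record
  { IsOpen            = BoxOpen
  ; open-respects     = λ W-open (x≈x′ , y≈y′) p∈W →
      let (_ , _ , V-open , V′-open , (x∈V , y∈V′) , V×V′⊆W) = W-open p∈W
      in V×V′⊆W ( T.open-respects V-open x≈x′ x∈V
                , S.open-respects V′-open y≈y′ y∈V′ )
  ; universe-open     = λ _ →
      U , U , T.universe-open , S.universe-open , (tt , tt) , λ _ → tt
  ; intersection-open = λ V-open W-open (p∈V , p∈W) →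
      let (_ , _ , V₁ , V₂ , (x∈V₁ , y∈V₂) , V₁×V₂⊆V) = V-open p∈V
          (_ , _ , W₁ , W₂ , (x∈W₁ , y∈W₂) , W₁×W₂⊆W) = W-open p∈W
      in _ , _ , T.intersection-open V₁ W₁ , S.intersection-open V₂ W₂ ,
         ((x∈V₁ , x∈W₁) , (y∈V₂ , y∈W₂)) ,
         λ ((x∈V , x∈W) , (y∈V , y∈W)) →
           V₁×V₂⊆V (x∈V , y∈V) , W₁×W₂⊆W (x∈W , y∈W)
  ; union-open        = λ 𝒰 𝒰-open (W⊆⋃𝒰 , ⋃𝒰⊆W) p∈W →
      let (V , V∈𝒰 , p∈V) = W⊆⋃𝒰 p∈W
          (V₁ , V₂ , V₁-open , V₂-open , p∈V₁×V₂ , V₁×V₂⊆V) = 𝒰-open V∈𝒰 p∈V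
      in V₁ , V₂ , V₁-open , V₂-open , p∈V₁×V₂ ,
         λ q∈V₁×V₂ → ⋃𝒰⊆W (V , V∈𝒰 , V₁×V₂⊆V q∈V₁×V₂)
  }
  where
  module T = Topology τ
  module S = Topology σ
  BoxOpen : Pred (Pred (Setoid.Carrier X × Setoid.Carrier Y) (ℓ₁ ⊔ ℓ₂))
                 (suc (ℓ₁ ⊔ ℓ₂))
  BoxOpen W = ∀ {p} → p ∈ W →
    ∃₂ λ V V′ → IsOpen τ V × IsOpen σ V′ × p ∈ (V ⟨×⟩ V′) × (V ⟨×⟩ V′) ⊆ W

------------------------------------------------------------------------
-- Topological groups and their actions

record TopologicalGroup (ℓ : Level) : Set (suc (suc ℓ)) where
  field
    group : Group ℓ ℓ
  open Group group public
  field
    topology      : Topology setoid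
    ∙-continuous  : Continuous (topology ×ₜ topology) topology (uncurry _∙_)
    ⁻¹-continuous : Continuous topology topology _⁻¹

record Subgroup (G : Group ℓ ℓ) : Set (suc ℓ) where
  open Group G
  field
    Member    : Pred Carrier ℓ
    respects  : Member Respects _≈_
    ε-closed  : Member ε
    ∙-closed  : ∀ {g h} → Member g → Member h → Member (g ∙ h)
    ⁻¹-closed : ∀ {g} → Member g → Member (g ⁻¹)

record ContinuousAction (G : TopologicalGroup ℓ₁)
                        {X : Setoid (ℓ₁ ⊔ ℓ₂) (ℓ₁ ⊔ ℓ₂)}
                        (τ : Topology X) : Set (suc (ℓ₁ ⊔ ℓ₂)) where
  private
    module G = TopologicalGroup G
    module X = Setoid X
  infixr 7 _·_
  field
    _·_        : G.Carrier → X.Carrier → X.Carrier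
    ·-cong     : ∀ {g h x y} → g G.≈ h → x X.≈ y → g · x X.≈ h · y
    identity   : ∀ x → G.ε · x X.≈ x
    compatible : ∀ g h x → (g G.∙ h) · x X.≈ g · h · x
    continuous : Continuous (G.topology ×ₜ τ) τ (uncurry _·_)

RelativelyExtremelyAmenable :
  ∀ ℓ₂ (G : TopologicalGroup ℓ₁) → Subgroup (TopologicalGroup.group G) →
  Set (suc (suc (ℓ₁ ⊔ ℓ₂)))
RelativelyExtremelyAmenable {ℓ₁} ℓ₂ G H =
  (X : Setoid (ℓ₁ ⊔ ℓ₂) (ℓ₁ ⊔ ℓ₂)) (τ : Topology X) →
  Setoid.Carrier X → Hausdorff τ → Compact τ →
  (action : ContinuousAction {ℓ₂ = ℓ₂} G τ) →
  let open Setoid X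
      open ContinuousAction action
  in ∃[ x ] ∀ h → h ∈ Subgroup.Member H → h · x ≈ x

------------------------------------------------------------------------
-- First-order structures

Countable : Set → Set
Countable A = A ↣ ℕ

Finite : Set → Set
Finite A = ∃[ n ] A ↔ Fin n

record RelationalSignature : Set₁ where
  field
    Symbol : Set
    arity  : Symbol → ℕ

-- Constants are function symbols of arity 0.
record Signature : Set₁ where
  field
    FunctionSymbol : Set
    functionArity  : FunctionSymbol → ℕ
    RelationSymbol : Set
    relationArity  : RelationSymbol → ℕ

CountableSignature : Signature → Set
CountableSignature L = Countable FunctionSymbol × Countable RelationSymbol
  where open Signature L

infixl 6 _⊕_

_⊕_ : Signature → RelationalSignature → Signature
L ⊕ E = record
  { FunctionSymbol = L.FunctionSymbol
  ; functionArity  = L.functionArity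
  ; RelationSymbol = L.RelationSymbol ⊎ E.Symbol
  ; relationArity  = [ L.relationArity , E.arity ]′
  }
  where
  module L = Signature L
  module E = RelationalSignature E

record Structure (L : Signature) : Set₁ where
  open Signature L
  field
    Carrier : Set
    fun     : (f : FunctionSymbol) → Vec Carrier (functionArity f) → Carrier
    rel     : (r : RelationSymbol) → Pred (Vec Carrier (relationArity r)) 0ℓ

open Structure using (Carrier; fun; rel)

module _ {L : Signature} where

  record IsEmbedding (A B : Structure L) (h : Carrier A → Carrier B) : Set where
    field
      injective : Injective _≡_ _≡_ h
      fun-homo  : ∀ f v → h (fun A f v) ≡ fun B f (Vec.map h v)
      rel-iff   : ∀ r v → rel A r v ⇔ rel B r (Vec.map h v)

  record Embedding (A B : Structure L) : Set where
    field
      to          : Carrier A → Carrier B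
      isEmbedding : IsEmbedding A B to
    open IsEmbedding isEmbedding public

  record Isomorphism (A B : Structure L) : Set where
    field
      bijection   : Carrier A ↔ Carrier B
      isEmbedding : IsEmbedding A B (Inverse.to bijection)
    open Inverse bijection public using (to; from; strictlyInverseˡ; strictlyInverseʳ)
    open IsEmbedding isEmbedding public

  isEmbedding-id : (A : Structure L) → IsEmbedding A A id
  isEmbedding-id A = record
    { injective = id
    ; fun-homo  = λ f v → cong (fun A f) (sym (map-id v))
    ; rel-iff   = λ r v → subst (λ w → rel A r v ⇔ rel A r w) (sym (map-id v)) (⇔-id _)
    }

  isEmbedding-∘ : {A B C : Structure L} {g : Carrier B → Carrier C} {h : Carrier A → Carrier B} →
                  IsEmbedding B C g → IsEmbedding A B h → IsEmbedding A C (g ∘ h)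
  isEmbedding-∘ {A} {B} {C} {g} {h} G H = record
    { injective = H.injective ∘ G.injective
    ; fun-homo  = λ f v → let open ≡-Reasoning in begin
        g (h (fun A f v))                   ≡⟨ cong g (H.fun-homo f v) ⟩
        g (fun B f (Vec.map h v))           ≡⟨ G.fun-homo f (Vec.map h v) ⟩
        fun C f (Vec.map g (Vec.map h v))   ≡⟨ cong (fun C f) (map-∘ g h v) ⟨
        fun C f (Vec.map (g ∘ h) v)         ∎
    ; rel-iff   = λ r v → subst (λ w → rel A r v ⇔ rel C r w) (sym (map-∘ g h v))
                                (G.rel-iff r (Vec.map h v) ⇔-∘ H.rel-iff r v)
    }
    where
    module G = IsEmbedding G
    module H = IsEmbedding H

  infixr 9 _∘ₑ_

  _∘ₑ_ : {A B C : Structure L} → Embedding B C → Embedding A B → Embedding A C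
  g ∘ₑ h = record
    { isEmbedding = isEmbedding-∘ (Embedding.isEmbedding g) (Embedding.isEmbedding h) }

  -- Embeddings are compared as functions, ignoring their proof components.
  Embeddings : Structure L → Structure L → Setoid 0ℓ 0ℓ
  Embeddings A B = record
    { Carrier       = Embedding A B
    ; _≈_           = λ g h → ∀ x → Embedding.to g x ≡ Embedding.to h x
    ; isEquivalence = record
      { refl  = λ _ → refl
      ; sym   = λ g≈h x → sym (g≈h x)
      ; trans = λ f≈g g≈h x → trans (f≈g x) (g≈h x)
      }
    }

  isomorphism-id : {A : Structure L} → Isomorphism A A
  isomorphism-id {A} = record { bijection = ↔-id _ ; isEmbedding = isEmbedding-id A }

  isomorphism-∘ : {A B C : Structure L} → Isomorphism B C → Isomorphism A B → Isomorphism A C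
  isomorphism-∘ g h = record
    { bijection   = Isomorphism.bijection g ↔-∘ Isomorphism.bijection h
    ; isEmbedding = isEmbedding-∘ (Isomorphism.isEmbedding g) (Isomorphism.isEmbedding h)
    }

  isomorphism-sym : {A B : Structure L} → Isomorphism A B → Isomorphism B A
  isomorphism-sym {A} {B} h = record
    { bijection   = ↔-sym H.bijection
    ; isEmbedding = record
      { injective = λ {x} {y} eq →
          trans (sym (H.strictlyInverseˡ x)) (trans (cong H.to eq) (H.strictlyInverseˡ y))
      ; fun-homo  = λ f v → let open ≡-Reasoning in begin
          H.from (fun B f v)                                   ≡⟨ cong (H.from ∘ fun B f) (to∘from v) ⟨
          H.from (fun B f (Vec.map H.to (Vec.map H.from v)))   ≡⟨ cong H.from (H.fun-homo f _) ⟨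
          H.from (H.to (fun A f (Vec.map H.from v)))           ≡⟨ H.strictlyInverseʳ _ ⟩
          fun A f (Vec.map H.from v)                           ∎
      ; rel-iff   = λ r v → ⇔-sym
          (subst (λ w → rel A r (Vec.map H.from v) ⇔ rel B r w) (to∘from v)
                 (H.rel-iff r (Vec.map H.from v)))
      }
    }
    where
    module H = Isomorphism h
    to∘from : ∀ {n} (v : Vec (Carrier B) n) → Vec.map H.to (Vec.map H.from v) ≡ v
    to∘from v = trans (sym (map-∘ H.to H.from v)) (trans (map-cong H.strictlyInverseˡ v) (map-id v))

  Automorphism : Structure L → Set
  Automorphism A = Isomorphism A A

  Rigid : Structure L → Set
  Rigid A = (g : Automorphism A) → ∀ x → Isomorphism.to g x ≡ x

  record Substructure (M : Structure L) : Set₁ where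
    field
      Member : Pred (Carrier M) 0ℓ
      closed : ∀ f v → VecAll.All Member v → Member (fun M f v)

    members : ∀ {n} (v : Vec [ x ∈ Carrier M ∣ Member x ] n) →
              Irrelevant.Irrelevant (VecAll.All Member (Vec.map value v))
    members []            = Irrelevant.pure []
    members ((_ , p) ∷ v) = Irrelevant.zipWith _∷_ p (members v)

    -- Irrelevance of membership proofs makes propositional equality on the
    -- carrier coincide with equality in M.
    structure : Structure L
    structure = record
      { Carrier = [ x ∈ Carrier M ∣ Member x ]
      ; fun     = λ f v → fun M f (Vec.map value v) , Irrelevant.map (closed f _) (members v)
      ; rel     = λ r v → rel M r (Vec.map value v)
      }

  data Generated (M : Structure L) (xs : List (Carrier M)) : Pred (Carrier M) 0ℓ where
    generator : ∀ {x} → x ∈ₗ xs → Generated M xs x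
    apply     : ∀ f v → VecAll.All (Generated M xs) v → Generated M xs (fun M f v)

  ⟨_⟩ : {M : Structure L} → List (Carrier M) → Substructure M
  ⟨_⟩ {M} xs = record { Member = Generated M xs ; closed = apply }

  FiniteStructure : Structure L → Set
  FiniteStructure A = Finite (Carrier A)

  LocallyFinite : Structure L → Set
  LocallyFinite M = (xs : List (Carrier M)) →
    FiniteStructure (Substructure.structure {M = M} ⟨ xs ⟩)

  Ultrahomogeneous : Structure L → Set₁
  Ultrahomogeneous M = (A B : Substructure M) →
    let open Substructure in
    FiniteStructure (structure A) → FiniteStructure (structure B) →
    (φ : Isomorphism (structure A) (structure B)) →
    Σ[ g ∈ Automorphism M ]
      ∀ x → Isomorphism.to g (value x) ≡ value (Isomorphism.to φ x)

  record Fraïssé (M : Structure L) : Set₁ where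
    field
      countablyInfinite : Carrier M ↔ ℕ
      locallyFinite     : LocallyFinite M
      ultrahomogeneous  : Ultrahomogeneous M

  Age : Structure L → Pred (Structure L) 0ℓ
  Age M A = FiniteStructure A × Embedding A M

------------------------------------------------------------------------
-- Automorphism groups

  AutGroup : Structure L → Group 0ℓ 0ℓ
  AutGroup M = record
    { Carrier = Automorphism M
    ; _≈_     = λ g h → ∀ x → to g x ≡ to h x
    ; _∙_     = isomorphism-∘
    ; ε       = isomorphism-id
    ; _⁻¹     = isomorphism-sym
    ; isGroup = record
      { isMonoid = record
        { isSemigroup = record
          { isMagma = record
            { isEquivalence = record
              { refl  = λ _ → refl
              ; sym   = λ g≈h x → sym (g≈h x)
              ; trans = λ f≈g g≈h x → trans (f≈g x) (g≈h x)
              }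
            ; ∙-cong = λ {g} g≈g′ h≈h′ x → trans (cong (to g) (h≈h′ x)) (g≈g′ _)
            }
          ; assoc = λ _ _ _ _ → refl
          }
        ; identity = (λ _ _ → refl) , (λ _ _ → refl)
        }
      ; inverse = strictlyInverseʳ , strictlyInverseˡ
      ; ⁻¹-cong = λ {g} {h} → from-cong g h
      }
    }
    where
    open Isomorphism
    from-cong : (g h : Automorphism M) → (∀ x → to g x ≡ to h x) → ∀ x → from g x ≡ from h x
    from-cong g h g≈h x = injective h
      (trans (sym (g≈h _)) (trans (strictlyInverseˡ g x) (sym (strictlyInverseˡ h x))))

  AgreeOn : (M : Structure L) → List (Carrier M) → (g h : Automorphism M) → Set
  AgreeOn M xs g h = All (λ x → Isomorphism.to g x ≡ Isomorphism.to h x) xs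

  -- Topology of pointwise convergence, the carrier of M being discrete: the
  -- sets { h | h agrees with g on xs }, xs finite, form a neighbourhood base
  -- at g.
  PointwiseOpen : (M : Structure L) → Pred (Pred (Automorphism M) 0ℓ) (suc 0ℓ)
  PointwiseOpen M V = Level.Lift _
    (∀ g → g ∈ V → ∃[ xs ] ∀ h → AgreeOn M xs g h → h ∈ V)

  Aut : Structure L → TopologicalGroup 0ℓ
  Aut M = record
    { group         = AutGroup M
    ; topology      = τ
    ; ∙-continuous  = λ V (lift V-open) {(g , h)} gh∈V →
        let (xs , near) = V-open (isomorphism-∘ g h) gh∈V in
        (λ g′ → AgreeOn M (List.map (to h) xs) g g′) ,
        (λ h′ → AgreeOn M xs h h′) ,
        agree-open _ g , agree-open _ h ,
        (ListAll.universal (λ _ → refl) _ , ListAll.universal (λ _ → refl) _) ,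
        λ {(g′ , h′)} (g-agree , h-agree) →
          near _ (ListAll.zipWith
            (λ {x} (p , q) → trans p (cong (to g′) q))
            (ListAll.map⁻ g-agree , h-agree))
    ; ⁻¹-continuous = λ V (lift V-open) → lift λ g g⁻¹∈V →
        let (xs , near) = V-open (isomorphism-sym g) g⁻¹∈V in
        List.map (from g) xs , λ h agree →
          near _ (ListAll.map
            (λ {x} p → injective h
              (trans (sym p) (trans (strictlyInverseˡ g x) (sym (strictlyInverseˡ h x)))))
            (ListAll.map⁻ agree))
    }
    where
    open Isomorphism
    open Level using (lift)

    agree-open : ∀ xs g → PointwiseOpen M (AgreeOn M xs g)
    agree-open xs g = lift λ h g-h → xs , λ k h-k →
      ListAll.zipWith (λ (p , q) → trans p q) (g-h , h-k)

    τ : Topology (Group.setoid (AutGroup M))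
    τ = record
      { IsOpen            = PointwiseOpen M
      ; open-respects     = λ (lift V-open) {g} {h} g≈h g∈V →
          proj₂ (V-open g g∈V) h (ListAll.universal g≈h _)
      ; universe-open     = lift λ _ _ → List.[] , λ _ _ → tt
      ; intersection-open = λ (lift V-open) (lift W-open) → lift λ g (g∈V , g∈W) →
          let (xs , nearV) = V-open g g∈V
              (ys , nearW) = W-open g g∈W
          in xs List.++ ys , λ h agree →
            nearV h (ListAll.++⁻ˡ xs agree) , nearW h (ListAll.++⁻ʳ xs agree)
      ; union-open        = λ 𝒰 𝒰-open (W⊆⋃𝒰 , ⋃𝒰⊆W) → lift λ g g∈W →
          let (V , V∈𝒰 , g∈V) = W⊆⋃𝒰 g∈W
              (xs , near) = Level.lower (𝒰-open V∈𝒰) g g∈V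
          in xs , λ h agree → ⋃𝒰⊆W (V , V∈𝒰 , near h agree)
      }

------------------------------------------------------------------------
-- Relational expansions

module _ {L : Signature} {E : RelationalSignature} where

  reduct : Structure (L ⊕ E) → Structure L
  reduct A* = record
    { Carrier = Carrier A* ; fun = fun A* ; rel = λ r → rel A* (inj₁ r) }

  -- Expansions of A are given by their interpretations of the new symbols,
  -- so that reduct (expand A R) is definitionally A.
  NewRelations : Structure L → Set₁
  NewRelations A = (i : Symbol) → Pred (Vec (Carrier A) (arity i)) 0ℓ
    where open RelationalSignature E

  expand : (A : Structure L) → NewRelations A → Structure (L ⊕ E)
  expand A R = record
    { Carrier = Carrier A
    ; fun     = fun A
    ; rel     = λ { (inj₁ r) → rel A r ; (inj₂ i) → R i }
    }

  SameRelations : (A : Structure L) → NewRelations A → NewRelations A → Set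
  SameRelations A R S = ∀ i v → R i v ⇔ S i v

  Precompact : (F : Structure L) → NewRelations F → Set₁
  Precompact F R = ∀ A → A ∈ Age F →
    Σ[ Ss ∈ List (NewRelations A) ]
      (∀ S → expand A S ∈ Age (expand F R) → Any (SameRelations A S) Ss)

  AutExpansion : (F : Structure L) (R : NewRelations F) → Subgroup (AutGroup F)
  AutExpansion F R = record
    { Member    = λ g → Σ[ g* ∈ Automorphism (expand F R) ] (∀ x → to g* x ≡ to g x)
    ; respects  = λ g≈h (g* , g*≈g) → g* , λ x → trans (g*≈g x) (g≈h x)
    ; ε-closed  = isomorphism-id , λ _ → refl
    ; ∙-closed  = λ {g} {h} (g* , g*≈g) (h* , h*≈h) →
        isomorphism-∘ g* h* , λ x → trans (cong (to g*) (h*≈h x)) (g*≈g _)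
    ; ⁻¹-closed = λ {g} (g* , g*≈g) → isomorphism-sym g* , λ x → injective g
        (trans (sym (g*≈g _)) (trans (strictlyInverseˡ g* x) (sym (strictlyInverseˡ g x))))
    }
    where open Isomorphism

  inducedRelations : (B* : Structure (L ⊕ E)) {A : Structure L} →
                     Embedding A (reduct B*) → NewRelations A
  inducedRelations B* a i v = rel B* (inj₂ i) (Vec.map (Embedding.to a) v)

  SameInducedExpansion : (B* : Structure (L ⊕ E)) {A : Structure L} →
                         (a a′ : Embedding A (reduct B*)) → Set
  SameInducedExpansion B* {A} a a′ =
    SameRelations A (inducedRelations B* a) (inducedRelations B* a′)

  RelativeRamsey : Pred (Structure L) 0ℓ → Pred (Structure (L ⊕ E)) 0ℓ → Set₁
  RelativeRamsey K K* =
    ∀ (k : ℕ) A → A ∈ K → ∀ B* → B* ∈ K* →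
    Σ[ C ∈ Structure L ] C ∈ K ×
    ((c : Embeddings A C ⟶ₛ ≡.setoid (Fin k)) →
     Σ[ b ∈ Embedding (reduct B*) C ]
       (∀ a₀ a₁ → SameInducedExpansion B* a₀ a₁ →
        Func.to c (b ∘ₑ a₀) ≡ Func.to c (b ∘ₑ a₁)))

{-# OPTIONS --safe #-}
module Submission where

-- Amenability implies the Ramsey property.  Fix k, A and B*, and call a
-- k-coloring of the embeddings of A in F bad if no embedding b of B in F is
-- good for it, where b is good if the coloring is constant, through b, on
-- embeddings of A in B that induce the same expansion.
-- The bad colorings form a closed G-invariant set of colorings.  If it were
-- nonempty, some bad coloring would be fixed by G*; but the embedding of B*
-- in F* shows that a G*-fixed coloring is not bad, because embeddings of A
-- that induce the same expansion differ by an element of G*, by homogeneity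
-- of F* (extend, no-fixed-point).  So for every coloring some b is good.
-- Whether b is good depends on finitely many values of the coloring, so
-- finitely many b suffice by compactness (finiteSubcover), and C is the
-- substructure generated by their images and a copy of A (amenable⇒ramsey).
--
-- The Ramsey property already implies rigidity.  Let φ be an automorphism of
-- A* that moves x, and color an embedding a of A in C according to whether
-- a(x) precedes a(φ(x)) in an enumeration of C.  All powers of φ induce the
-- same expansion, so for a suitable b the sequence of positions of
-- b(φ^j(x)) would be strictly monotone in j, which is impossible in the
-- finite structure C (monotone-bounded⇒⊥, ramsey⇒rigid).
--
-- The Ramsey property implies amenability.  Suppose that G acts on a compact
-- space X without a G*-fixed point.  The space is covered by finitely many
-- open sets V i, each displaced off itself by some h i in G*.  A Lebesgue
-- number argument gives a finite list xs of points of F such that the orbit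
-- of every point of X under the stabilizer of xs lies in a single V i.
-- Hence an embedding a of A = ⟨xs⟩ in F can be given a color i such that
-- g⁻¹ x₀ lies in V i for every g extending a.  Let B* be generated in F* by
-- xs and all its translates by the h i.  All the embeddings h i of A in B
-- induce the same expansion as the inclusion, so the Ramsey property gives b
-- for which they all have the same color i as the inclusion.  For g extending b,
-- both z = g⁻¹ x₀ and (g h i)⁻¹ x₀ = (h i)⁻¹ z then lie in V i, although h i
-- maps the second to the first (not-both-captured).
--
-- Excluded middle also serves as a choice principle: it either produces an
-- element of a type or refutes its existence.

open import Defs
open import Axiom.ExcludedMiddle using (ExcludedMiddle)
open import Data.Empty using (⊥; ⊥-elim)
open import Data.Fin.Base as Fin using (Fin)
open import Data.Fin.Properties as Fin using (finToFun-funToFin)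
open import Data.Irrelevant using (Irrelevant; [_])
open import Data.List.Base as List using (List; []; _∷_; _++_)
open import Data.List.Membership.Propositional using (find) renaming (_∈_ to _∈ₗ_)
open import Data.List.Membership.Propositional.Properties using (∈-lookup; ∈-map⁺)
open import Data.List.Relation.Unary.All as All using (All; []; _∷_)
import Data.List.Relation.Unary.All.Properties as All
open import Data.List.Relation.Unary.Any as Any using (Any; here; there)
import Data.List.Relation.Unary.Any.Properties as Any
open import Data.Nat.Base as ℕ
  using (ℕ; zero; suc; _+_; _≤_; _<_; _⊔_; _≤′_; ≤′-refl; ≤′-step)
import Data.Nat.Binary.Base as ℕᵇ
import Data.Nat.Binary.Properties as ℕᵇ
import Data.Nat.Properties as ℕ
open import Data.Product.Base using (Σ-syntax; ∃; ∃-syntax; _×_; _,_; proj₁; proj₂)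
open import Data.Refinement.Base using (value; _,_)
open import Data.Refinement.Properties using (value-injective)
open import Data.Sum.Base using (_⊎_; inj₁; inj₂)
open import Data.Vec.Base as Vec using (Vec; []; _∷_)
open import Data.Vec.Properties using (map-∘; map-cong)
open import Data.Vec.Relation.Unary.All as VecAll using ([]; _∷_)
open import Function.Base using (_∘_)
open import Function.Bundles
  using (Func; Inverse; Equivalence; Injection; _↔_; _⇔_; _⟶ₛ_; mk↔ₛ′; mk⇔)
open import Function.Construct.Composition using (_↔-∘_; _⇔-∘_)
open import Function.Construct.Identity using (⇔-id)
open import Function.Construct.Symmetry using (↔-sym; ⇔-sym)
open import Function.Properties.Inverse using (Inverse⇒Injection)
open import Level using (Level; 0ℓ; Lift; lift; lower)
open import Relation.Binary.Bundles using (Setoid)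
open import Relation.Binary.PropositionalEquality
  using (_≡_; _≢_; refl; sym; trans; cong; cong₂; subst; subst₂; setoid; module ≡-Reasoning)
open import Relation.Nullary.Decidable.Core using (Dec; yes; no; recompute; decidable-stable)
open import Relation.Nullary.Negation using (¬_; contradiction)
open import Relation.Unary using (Pred; _∈_; _≐_)

open Structure using (Carrier; fun; rel)
open Substructure using (Member; closed; structure)

------------------------------------------------------------------------
-- Embeddings, substructures and reducts

module _ {L : Signature} where

  inclusion : {M : Structure L} (S : Substructure M) → Embedding (structure S) M
  inclusion S = record
    { to          = value
    ; isEmbedding = record
      { injective = value-injective
      ; fun-homo  = λ f v → refl
      ; rel-iff   = λ r v → ⇔-id _
      }
    }

  -- An embedding whose values lie in S, as an embedding in S.
  corestrict : {A M : Structure L} (S : Substructure M) (a : Embedding A M) →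
               (∀ x → Irrelevant (Member S (Embedding.to a x))) →
               Embedding A (structure S)
  corestrict {A} {M} S a p = record
    { to          = to′
    ; isEmbedding = record
      { injective = λ eq → injective (cong value eq)
      ; fun-homo  = λ f v → value-injective
          (trans (fun-homo f v) (cong (fun M f) (map-∘ value to′ v)))
      ; rel-iff   = λ r v →
          subst (λ w → rel A r v ⇔ rel M r w) (map-∘ value to′ v) (rel-iff r v)
      }
    }
    where
    open Embedding a
    to′ : Carrier A → Carrier (structure S)
    to′ x = to x , p x

  asEmbedding : {A B : Structure L} → Isomorphism A B → Embedding A B
  asEmbedding φ = record { isEmbedding = Isomorphism.isEmbedding φ }

  -- The range of an embedding, as a substructure.
  image : {A M : Structure L} → Embedding A M → Substructure M
  image {A} {M} a = record
    { Member = InImage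
    ; closed = λ f v ps →
        let (w , aw≡v) = preimages ps
        in fun A f w , trans (fun-homo f w) (cong (fun M f) aw≡v)
    }
    where
    open Embedding a
    InImage : Pred (Carrier M) 0ℓ
    InImage y = ∃[ x ] to x ≡ y

    preimages : ∀ {n} {v : Vec (Carrier M) n} → VecAll.All InImage v →
                ∃[ w ] Vec.map to w ≡ v
    preimages []             = [] , refl
    preimages ((x , p) ∷ ps) =
      let (w , q) = preimages ps in x ∷ w , cong₂ _∷_ p q

module _ {L : Signature} {E : RelationalSignature} where

  reductEmbedding : {A* B* : Structure (L ⊕ E)} → Embedding A* B* →
                    Embedding (reduct {L} {E} A*) (reduct {L} {E} B*)
  reductEmbedding a = record
    { isEmbedding = record
      { injective = injective
      ; fun-homo  = fun-homo
      ; rel-iff   = λ r → rel-iff (inj₁ r)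
      }
    }
    where open Embedding a

  reductAutomorphism : {A* : Structure (L ⊕ E)} → Automorphism A* →
                       Automorphism (reduct {L} {E} A*)
  reductAutomorphism g = record
    { bijection   = Isomorphism.bijection g
    ; isEmbedding = Embedding.isEmbedding (reductEmbedding (asEmbedding g))
    }

  -- An embedding of A in the reduct of B* embeds in B* the expansion of A that it
  -- induces, and any expansion with the same relations.
  expandEmbedding : {A : Structure L} {B* : Structure (L ⊕ E)} {S : NewRelations {L} {E} A}
                    (a : Embedding A (reduct B*)) →
                    SameRelations A S (inducedRelations B* a) →
                    Embedding (expand A S) B*
  expandEmbedding a same = record
    { to          = to
    ; isEmbedding = record
      { injective = injective
      ; fun-homo  = fun-homo
      ; rel-iff   = λ { (inj₁ r) v → rel-iff r v ; (inj₂ i) v → same i v }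
      }
    }
    where open Embedding a

  reductAge : {F : Structure L} {R : NewRelations {L} {E} F} {A* : Structure (L ⊕ E)} →
              A* ∈ Age (expand F R) → reduct A* ∈ Age F
  reductAge (fin , a) = fin , reductEmbedding a

------------------------------------------------------------------------
-- An enumeration of the finite sequences of natural numbers

-- The entry at a given position, and 0 past the end of the list.
nth : List ℕ → ℕ → ℕ
nth []       _       = 0
nth (x ∷ xs) zero    = x
nth (x ∷ xs) (suc i) = nth xs i

nth-tabulate : ∀ {n} (f : Fin n → ℕ) i → nth (List.tabulate f) (Fin.toℕ i) ≡ f i
nth-tabulate f Fin.zero    = refl
nth-tabulate f (Fin.suc i) = nth-tabulate (f ∘ Fin.suc) i

incrementHead : List ℕ → List ℕ
incrementHead []       = []
incrementHead (x ∷ xs) = suc x ∷ xs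

-- The binary numerals with digits 1 and 2 are words in two letters; reading
-- them as instructions (2: prepend 0, 1: increment the first entry) yields
-- every finite sequence.
decode : ℕᵇ.ℕᵇ → List ℕ
decode ℕᵇ.zero     = []
decode ℕᵇ.2[1+ b ] = 0 ∷ decode b
decode ℕᵇ.1+[2 b ] = incrementHead (decode b)

encode-∷ : ∀ x b → ∃[ b′ ] decode b′ ≡ x ∷ decode b
encode-∷ zero    b = ℕᵇ.2[1+ b ] , refl
encode-∷ (suc x) b = let (b′ , eq) = encode-∷ x b in ℕᵇ.1+[2 b′ ] , cong incrementHead eq

encode : ∀ xs → ∃[ b ] decode b ≡ xs
encode []       = ℕᵇ.zero , refl
encode (x ∷ xs) =
  let (b , eq) = encode xs ; (b′ , eq′) = encode-∷ x b in b′ , trans eq′ (cong (x ∷_) eq)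

lists : ℕ → List ℕ
lists = decode ∘ ℕᵇ.fromℕ

lists-onto : ∀ xs → ∃[ n ] lists n ≡ xs
lists-onto xs =
  let (b , eq) = encode xs in ℕᵇ.toℕ b , trans (cong decode (ℕᵇ.fromℕ-toℕ b)) eq

------------------------------------------------------------------------
-- The Ramsey property implies rigidity

-- A bounded sequence of natural numbers whose steps all go in the same
-- direction as its first one must repeat a value at some step.
monotone-bounded⇒⊥ : (f : ℕ → ℕ) (n : ℕ) → (∀ j → f j < n) → (∀ j → f j ≢ f (suc j)) →
                     (∀ j → f 0 < f 1 ⇔ f j < f (suc j)) → ⊥
monotone-bounded⇒⊥ f n f<n f-moves monotone with f 0 ℕ.<? f 1
... | yes f0<f1 = ℕ.<⇒≱ (f<n n) (grows n)
  where
  grows : ∀ j → j ≤ f j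
  grows zero    = ℕ.z≤n
  grows (suc j) = ℕ.≤-<-trans (grows j) (Equivalence.to (monotone j) f0<f1)
... | no f0≮f1 = ℕ.<⇒≱ (ℕ.m≤n+m (suc (f 0)) (f (suc (f 0)))) (shrinks (suc (f 0)))
  where
  descends : ∀ j → f (suc j) < f j
  descends j = ℕ.≤∧≢⇒< (ℕ.≮⇒≥ (f0≮f1 ∘ Equivalence.from (monotone j))) (f-moves j ∘ sym)
  shrinks : ∀ j → f j + j ≤ f 0
  shrinks zero    = ℕ.≤-reflexive (ℕ.+-identityʳ _)
  shrinks (suc j) = ℕ.≤-trans (ℕ.≤-reflexive (ℕ.+-suc _ j))
    (ℕ.≤-trans (ℕ.+-monoˡ-≤ j (descends j)) (shrinks j))

-- The answer to a decidable question, as one of two colors.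
verdict : {P : Set} → Dec P → Fin 2
verdict (yes _) = Fin.zero
verdict (no _)  = Fin.suc Fin.zero

verdict-≡ : {P Q : Set} (p? : Dec P) (q? : Dec Q) → verdict p? ≡ verdict q? → P → Q
verdict-≡ _        (yes q) _  _ = q
verdict-≡ (yes _)  (no _)  () _
verdict-≡ (no ¬p)  (no _)  _  p = contradiction p ¬p

ramsey⇒rigid : {L : Signature} {E : RelationalSignature} {F : Structure L}
               {R : NewRelations {L} {E} F} →
               RelativeRamsey (Age F) (Age (expand F R)) →
               ∀ A* → A* ∈ Age (expand F R) → Rigid A*
ramsey⇒rigid {L} {E} {F} {R} ramsey A* A*∈Age φ x =
  Embedding.injective b (Injection.injective (Inverse⇒Injection (proj₂ C-finite))
    (decidable-stable (C.to (to b (φ.to x)) Fin.≟ C.to (to b x)) λ moved →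
      monotone-bounded⇒⊥ orbit (proj₁ C-finite) (λ j → Fin.toℕ<n _)
        (orbit-moves moved) monotone))
  where
  open Embedding using (to)
  A : Structure L
  A = reduct {L} {E} A*

  module φ = Isomorphism φ

  -- The powers of φ.
  iterate : ℕ → Embedding A* A*
  iterate zero    = record { isEmbedding = isEmbedding-id A* }
  iterate (suc n) = iterate n ∘ₑ asEmbedding φ

  power : ℕ → Embedding A A
  power n = reductEmbedding (iterate n)

  same : ∀ n → SameInducedExpansion A* (power 0) (power n)
  same n i v =
    Embedding.rel-iff (iterate n) (inj₂ i) v ⇔-∘
    ⇔-sym (Embedding.rel-iff (iterate 0) (inj₂ i) v)

  statement = ramsey 2 A (reductAge {F = F} A*∈Age) A* A*∈Age
  C = proj₁ statement
  C-finite : FiniteStructure C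
  C-finite = proj₁ (proj₁ (proj₂ statement))
  module C = Inverse (proj₂ C-finite)

  -- The index of a(y) in the enumeration of C.
  position : Embedding A C → Carrier A* → ℕ
  position a y = Fin.toℕ (C.to (to a y))

  ascending : Func (Embeddings A C) (setoid (Fin 2))
  ascending = record
    { to   = λ a → verdict (position a x ℕ.<? position a (φ.to x))
    ; cong = λ a≈a′ → cong₂ (λ y z → verdict (Fin.toℕ (C.to y) ℕ.<? Fin.toℕ (C.to z)))
        (a≈a′ x) (a≈a′ (φ.to x))
    }

  homogeneous = proj₂ (proj₂ statement) ascending
  b : Embedding A C
  b = proj₁ homogeneous

  orbit : ℕ → ℕ
  orbit j = position b (to (power j) x)

  monotone : ∀ j → orbit 0 < orbit 1 ⇔ orbit j < orbit (suc j)
  monotone j = mk⇔ (verdict-≡ first? later? eq) (verdict-≡ later? first? (sym eq))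
    where
    first? = orbit 0 ℕ.<? orbit 1
    later? = orbit j ℕ.<? orbit (suc j)
    eq : verdict first? ≡ verdict later?
    eq = proj₂ homogeneous (power 0) (power j) (same j)

  orbit-moves : ¬ (C.to (to b (φ.to x)) ≡ C.to (to b x)) → ∀ j → orbit j ≢ orbit (suc j)
  orbit-moves moved j eq = moved (cong (C.to ∘ to b) (sym
    (Embedding.injective (power j) (Embedding.injective b
      (Injection.injective (Inverse⇒Injection (proj₂ C-finite)) (Fin.toℕ-injective eq))))))

module Classical (em : ∀ {a} → ExcludedMiddle a) where

  ----------------------------------------------------------------------
  -- Homogeneity and enumeration of embeddings

  module _ {L : Signature} where

    -- Membership in a substructure is proof-irrelevant, so the inverse recomputes a
    -- preimage with excluded middle.
    imageIso : {A M : Structure L} (a : Embedding A M) → Isomorphism A (structure (image a))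
    imageIso {A} {M} a = record
      { bijection   = mk↔ₛ′ (Embedding.to onto) (proj₁ ∘ preimage)
          (λ y → value-injective (proj₂ (preimage y)))
          (λ x → Embedding.injective a (proj₂ (preimage (Embedding.to onto x))))
      ; isEmbedding = Embedding.isEmbedding onto
      }
      where
      onto : Embedding A (structure (image a))
      onto = corestrict (image a) a (λ x → [ (x , refl) ])
      preimage : (y : Carrier (structure (image a))) → ∃[ x ] Embedding.to a x ≡ value y
      preimage (y , [ p ]) = recompute em p

    -- In an ultrahomogeneous structure, any two embeddings of a finite structure
    -- differ by an automorphism.
    extend : {A M : Structure L} → Ultrahomogeneous M → FiniteStructure A →
             (a b : Embedding A M) →
             Σ[ g ∈ Automorphism M ]
               (∀ x → Isomorphism.to g (Embedding.to a x) ≡ Embedding.to b x)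
    extend {A} {M} homogeneous (n , A↔n) a b = g , λ x →
      trans (g-agrees (Isomorphism.to (imageIso a) x))
            (cong (Embedding.to b) (Isomorphism.strictlyInverseʳ (imageIso a) x))
      where
      finite : (c : Embedding A M) → FiniteStructure (structure (image c))
      finite c = n , (A↔n ↔-∘ ↔-sym (Isomorphism.bijection (imageIso c)))
      φ : Isomorphism (structure (image a)) (structure (image b))
      φ = isomorphism-∘ (imageIso b) (isomorphism-sym (imageIso a))
      extension = homogeneous (image a) (image b) (finite a) (finite b) φ
      g = proj₁ extension
      g-agrees = proj₂ extension

    -- The embedding with underlying function f if there is one, and a₀ otherwise.
    -- It turns an enumeration of functions into one of embeddings.
    pick : {A M : Structure L} → Embedding A M → (Carrier A → Carrier M) → Embedding A M
    pick {A} {M} a₀ f with em {P = Σ[ a ∈ Embedding A M ] (∀ x → Embedding.to a x ≡ f x)}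
    ... | yes (a , _) = a
    ... | no  _       = a₀

    pick-≈ : {A M : Structure L} (a₀ : Embedding A M) (f : Carrier A → Carrier M)
             (a : Embedding A M) → (∀ x → Embedding.to a x ≡ f x) →
             ∀ x → Embedding.to (pick a₀ f) x ≡ Embedding.to a x
    pick-≈ {A} {M} a₀ f a a≗f x
      with em {P = Σ[ a ∈ Embedding A M ] (∀ x → Embedding.to a x ≡ f x)}
    ... | yes (b , b≗f) = trans (b≗f x) (sym (a≗f x))
    ... | no  ¬f        = contradiction (a , a≗f) ¬f

  module _ {L : Signature} {A M : Structure L} (finite : FiniteStructure A)
           (countable : Carrier M ↔ ℕ) (a₀ : Embedding A M) where
    private
      module A = Inverse (proj₂ finite)
      module M = Inverse countable

    -- The function whose values, in the enumerations of A and M, are listed by the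
    -- n-th finite sequence of natural numbers.
    enumerated : ℕ → Carrier A → Carrier M
    enumerated n x = M.from (nth (lists n) (Fin.toℕ (A.to x)))

    embeddings : ℕ → Embedding A M
    embeddings n = pick a₀ (enumerated n)

    embeddings-onto : ∀ a → ∃[ n ] Setoid._≈_ (Embeddings A M) (embeddings n) a
    embeddings-onto a = n , pick-≈ a₀ (enumerated n) a (λ x → sym (begin
        M.from (nth (lists n) (Fin.toℕ (A.to x)))
          ≡⟨ cong (λ l → M.from (nth l (Fin.toℕ (A.to x)))) lists-n ⟩
        M.from (nth (List.tabulate values) (Fin.toℕ (A.to x)))
          ≡⟨ cong M.from (nth-tabulate values (A.to x)) ⟩
        M.from (M.to (Embedding.to a (A.from (A.to x))))
          ≡⟨ M.strictlyInverseʳ _ ⟩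
        Embedding.to a (A.from (A.to x))
          ≡⟨ cong (Embedding.to a) (A.strictlyInverseʳ x) ⟩
        Embedding.to a x ∎))
      where
      open ≡-Reasoning
      values : Fin (proj₁ finite) → ℕ
      values i = M.to (Embedding.to a (A.from i))
      n = proj₁ (lists-onto (List.tabulate values))
      lists-n = proj₂ (lists-onto (List.tabulate values))

  ----------------------------------------------------------------------
  -- Compactness of spaces of colorings

  module _ {I : Setoid 0ℓ 0ℓ} {k : ℕ} where
    open Setoid I using ()
      renaming (Carrier to Index; _≈_ to _≈ᵢ_; sym to ≈-sym; trans to ≈-trans)

    -- The k-colorings of the setoid I.  They carry the product topology, in which the
    -- colorings agreeing with c at a finite list of indices form a basic
    -- neighbourhood of c.
    Coloring : Set
    Coloring = I ⟶ₛ setoid (Fin k)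

    AgreeAt : List Index → Coloring → Coloring → Set
    AgreeAt is c d = All (λ i → Func.to c i ≡ Func.to d i) is

    -- Interior W c says that c has a basic neighbourhood contained in W.
    Interior : ∀ {b} → Pred Coloring b → Pred Coloring b
    Interior W c = ∃[ is ] ∀ d → AgreeAt is c d → d ∈ W

    -- A finite list of required values is a partial coloring p.
    Extends : List (Index × Fin k) → Pred Coloring 0ℓ
    Extends p c = All (λ (i , j) → Func.to c i ≡ j) p

    -- Compactness of the space of colorings, for I countable, in the form of König's
    -- lemma.  The sets W j need not be open, it is enough that their interiors cover.
    -- If no finite subfamily covers, the values at e 0, e 1, ... can be chosen in
    -- turn so that the colorings with the values chosen so far are never finitely
    -- covered.  The limit of this process lies in the interior of some W j, which
    -- covers all colorings extending a late enough stage.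
    module _ (e : ℕ → Index) (e-onto : ∀ i → ∃[ n ] e n ≈ᵢ i)
             {a b} {J : Set a} (W : J → Pred Coloring b)
             (W-covers : ∀ c → ∃[ j ] c ∈ Interior (W j)) where

      -- Finitely many W j cover the colorings that extend p.
      Covered : Pred (List (Index × Fin k)) _
      Covered p = ∃[ js ] ∀ c → c ∈ Extends p → Any (λ j → c ∈ W j) js

      -- If p is not finitely covered, then some value at i keeps it so, since
      -- finite covers for all k values at i would combine into one for p.
      step : ∀ p i → ¬ Covered p → ∃[ j ] ¬ Covered ((i , j) ∷ p)
      step p i ¬cov with em {P = ∃[ j ] ¬ Covered ((i , j) ∷ p)}
      ... | yes found = found
      ... | no ¬found = contradiction
        (List.concat (List.tabulate (proj₁ ∘ covered)) , λ c ext →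
          Any.concat⁺ (Any.tabulate⁺ (Func.to c i) (proj₂ (covered _) c (refl ∷ ext))))
        ¬cov
        where
        covered : ∀ j → Covered ((i , j) ∷ p)
        covered j with em {P = Covered ((i , j) ∷ p)}
        ... | yes cov  = cov
        ... | no ¬cov′ = contradiction (j , ¬cov′) ¬found

      module _ (¬cov : ¬ Covered []) where

        -- The first n values, together with the guarantee that they are not finitely
        -- covered.
        stage : ℕ → Σ[ p ∈ List (Index × Fin k) ] ¬ Covered p
        stage zero    = [] , ¬cov
        stage (suc n) =
          let (p , ¬c) = stage n ; (j , ¬c′) = step p (e n) ¬c in (e n , j) ∷ p , ¬c′

        decision : ℕ → Fin k
        decision n = proj₁ (step (proj₁ (stage n)) (e n) (proj₂ (stage n)))

        -- A coloring that extends a stage has the values chosen before that stage.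
        decided : ∀ {n N} c → suc n ≤′ N → c ∈ Extends (proj₁ (stage N)) →
                  Func.to c (e n) ≡ decision n
        decided c ≤′-refl       (eq ∷ _)  = eq
        decided c (≤′-step n<N) (_ ∷ ext) = decided c n<N ext

        -- A stage extended by no coloring would be covered by the empty family.
        inhabited : ∀ N → ∃[ c ] c ∈ Extends (proj₁ (stage N))
        inhabited N with em {P = ∃[ c ] c ∈ Extends (proj₁ (stage N))}
        ... | yes c = c
        ... | no ¬c =
          contradiction ([] , λ c ext → contradiction (c , ext) ¬c) (proj₂ (stage N))

        -- The sequence e may repeat an index up to equality.  The choices made for it
        -- agree, since some coloring extends a stage that includes both.
        decision-cong : ∀ {m n} → e m ≈ᵢ e n → decision m ≡ decision n
        decision-cong {m} {n} eq =
          let (c , ext) = inhabited (suc m ⊔ suc n)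
          in trans (sym (decided c (ℕ.≤⇒≤′ (ℕ.m≤m⊔n (suc m) (suc n))) ext))
               (trans (Func.cong c eq) (decided c (ℕ.≤⇒≤′ (ℕ.m≤n⊔m (suc m) (suc n))) ext))

        limit : Coloring
        limit = record
          { to   = λ i → decision (proj₁ (e-onto i))
          ; cong = λ {i} {i′} i≈i′ → decision-cong
              (≈-trans (proj₂ (e-onto i)) (≈-trans i≈i′ (≈-sym (proj₂ (e-onto i′)))))
          }

        -- A stage by which the values at the given indices have been chosen.
        bound : List Index → ℕ
        bound = List.foldr (λ i N → suc (proj₁ (e-onto i)) ⊔ N) 0

        limit-agrees : ∀ is {N} → bound is ≤ N →
                       ∀ c → c ∈ Extends (proj₁ (stage N)) → AgreeAt is limit c
        limit-agrees []       _  c ext = []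
        limit-agrees (i ∷ is) le c ext =
          trans (sym (decided c (ℕ.≤⇒≤′ (ℕ.m⊔n≤o⇒m≤o _ (bound is) le)) ext))
                (Func.cong c (proj₂ (e-onto i)))
          ∷ limit-agrees is (ℕ.m⊔n≤o⇒n≤o (suc (proj₁ (e-onto i))) _ le) c ext

        limit-covered : ⊥
        limit-covered = let (j , is , near) = W-covers limit in contradiction
          (j ∷ [] , λ c ext → here (near c (limit-agrees is ℕ.≤-refl c ext)))
          (proj₂ (stage (bound is)))

      finiteSubcover : ∃[ js ] ∀ c → Any (λ j → c ∈ W j) js
      finiteSubcover with em {P = Covered []}
      ... | yes (js , cov) = js , λ c → cov c []
      ... | no ¬cov        = ⊥-elim (limit-covered ¬cov)

  -- The subspace of the colorings that satisfy P, at an arbitrary universe level.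
  module ColoringSpace {I : Setoid 0ℓ 0ℓ} {k : ℕ}
                       (P : Pred (Coloring {I} {k}) 0ℓ) (ℓ : Level) where

    record Point : Set ℓ where
      constructor point
      field
        coloring : Coloring {I} {k}
        member   : P coloring
    open Point public

    points : Setoid ℓ ℓ
    points = record
      { Carrier       = Point
      ; _≈_           = λ p q → Lift ℓ (∀ i → Func.to (coloring p) i ≡ Func.to (coloring q) i)
      ; isEquivalence = record
        { refl  = lift λ _ → refl
        ; sym   = λ (lift eq) → lift λ i → sym (eq i)
        ; trans = λ (lift eq) (lift eq′) → lift λ i → trans (eq i) (eq′ i)
        }
      }

    Near : List (Setoid.Carrier I) → Point → Pred Point 0ℓ
    Near is p q = AgreeAt is (coloring p) (coloring q)

    topology : Topology points
    topology = record
      { IsOpen            = λ V → Lift (Level.suc ℓ)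
          (∀ p → p ∈ V → ∃[ is ] ∀ q → Near is p q → q ∈ V)
      ; open-respects     = λ (lift V-open) {p} {q} (lift p≈q) p∈V →
          let (is , near) = V-open p p∈V in near q (All.universal p≈q is)
      ; universe-open     = lift λ _ _ → [] , λ _ _ → _
      ; intersection-open = λ (lift V-open) (lift W-open) → lift λ p (p∈V , p∈W) →
          let (is , nearV) = V-open p p∈V
              (js , nearW) = W-open p p∈W
          in is ++ js , λ q agree → nearV q (All.++⁻ˡ is agree) , nearW q (All.++⁻ʳ is agree)
      ; union-open        = λ 𝒰 𝒰-open (W⊆⋃𝒰 , ⋃𝒰⊆W) → lift λ p p∈W →
          let (V , V∈𝒰 , p∈V) = W⊆⋃𝒰 p∈W
              (is , near)     = lower (𝒰-open V∈𝒰) p p∈V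
          in is , λ q agree → ⋃𝒰⊆W (V , V∈𝒰 , near q agree)
      }

    near-open : ∀ is p → Topology.IsOpen topology (λ q → Lift ℓ (Near is p q))
    near-open is p = lift λ q (lift p-q) → is , λ r q-r →
      lift (All.zipWith (λ (eq , eq′) → trans eq eq′) (p-q , q-r))

    hausdorff : Hausdorff topology
    hausdorff p q p≉q with em {P = ∃[ i ] ¬ (Func.to (coloring p) i ≡ Func.to (coloring q) i)}
    ... | yes (i , p≢q) =
      (λ r → Lift ℓ (Near (i ∷ []) p r)) , (λ r → Lift ℓ (Near (i ∷ []) q r)) ,
      near-open _ p , near-open _ q , lift (refl ∷ []) , lift (refl ∷ []) ,
      λ { (lift (eq ∷ []) , lift (eq′ ∷ [])) → p≢q (trans eq (sym eq′)) }
    ... | no ¬diff = contradiction (lift λ i → agree i) p≉q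
      where
      agree : ∀ i → Func.to (coloring p) i ≡ Func.to (coloring q) i
      agree i with em {P = Func.to (coloring p) i ≡ Func.to (coloring q) i}
      ... | yes eq = eq
      ... | no neq = contradiction (i , neq) ¬diff

    -- A subspace is compact if it is the complement of a union of open sets W j.  Those
    -- sets are added to the given cover, extended to all colorings, and the members
    -- of the finite subcover that come from the W j are then discarded.
    module _ (e : ℕ → Setoid.Carrier I) (e-onto : ∀ i → ∃[ n ] Setoid._≈_ I (e n) i)
             {J : Set} (W : J → Pred (Coloring {I} {k}) 0ℓ)
             (W-open : ∀ j {c} → c ∈ W j → c ∈ Interior (W j))
             (complement : ∀ {c} → (∀ j → ¬ c ∈ W j) → c ∈ P)
             (disjoint : ∀ {c} → c ∈ P → ∀ j → ¬ c ∈ W j) where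

      compact : Compact topology
      compact 𝒰 𝒰-open 𝒰-covers = proj₁ chosen , proj₁ (proj₂ chosen) , λ p →
          proj₂ (proj₂ chosen) p (proj₂ subcover (coloring p))
        where
        -- The second kind of set consists of V and the complement of the
        -- subspace.
        W′ : J ⊎ ∃ 𝒰 → Pred (Coloring {I} {k}) ℓ
        W′ (inj₁ j)       c = Lift ℓ (c ∈ W j)
        W′ (inj₂ (V , _)) c = (m : c ∈ P) → point c m ∈ V

        W′-covers : ∀ c → ∃[ j ] c ∈ Interior (W′ j)
        W′-covers c with em {P = ∃[ j ] c ∈ W j}
        ... | yes (j , c∈W) =
          let (is , near) = W-open j c∈W in inj₁ j , is , λ d agree → lift (near d agree)
        ... | no ¬c∈W =
          let m = complement λ j c∈W → ¬c∈W (j , c∈W)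
              (V , V∈𝒰 , c∈V) = 𝒰-covers (point c m)
              (is , near) = lower (𝒰-open V∈𝒰) (point c m) c∈V
          in inj₂ (V , V∈𝒰) , is , λ d agree m′ → near (point d m′) agree

        subcover = finiteSubcover {I} {k} e e-onto W′ W′-covers

        select : ∀ js → ∃[ Vs ] All 𝒰 Vs ×
                   (∀ p → Any (λ j → coloring p ∈ W′ j) js → Any (p ∈_) Vs)
        select []            = [] , [] , λ _ ()
        select (inj₁ j ∷ js) = let (Vs , Vs⊆𝒰 , cov) = select js in Vs , Vs⊆𝒰 , λ
          { p (here (lift c∈W)) → contradiction c∈W (disjoint (member p) j)
          ; p (there any)       → cov p any
          }
        select (inj₂ (V , V∈𝒰) ∷ js) =
          let (Vs , Vs⊆𝒰 , cov) = select js in V ∷ Vs , V∈𝒰 ∷ Vs⊆𝒰 , λ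
          { p (here p∈V)  → here (p∈V (member p))
          ; p (there any) → there (cov p any)
          }

        chosen = select (proj₁ subcover)

  ----------------------------------------------------------------------
  -- Relative extreme amenability implies the Ramsey property

  -- The coloring c is constant, through b, on embeddings that induce the same
  -- expansion from B*.
  Monochromatic : ∀ {L E k} {A C : Structure L} (B* : Structure (L ⊕ E)) →
                  Func (Embeddings A C) (setoid (Fin k)) → Embedding (reduct {L} {E} B*) C → Set
  Monochromatic {L} {E} {A = A} B* c b = ∀ (a₀ a₁ : Embedding A (reduct {L} {E} B*)) →
    SameInducedExpansion B* a₀ a₁ → Func.to c (b ∘ₑ a₀) ≡ Func.to c (b ∘ₑ a₁)

  module _ {L : Signature} {E : RelationalSignature} {F : Structure L} (fraïssé : Fraïssé F)
           {R : NewRelations {L} {E} F} (fraïssé* : Fraïssé (expand F R)) {ℓ : Level}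
           (amenable : RelativelyExtremelyAmenable ℓ (Aut F) (AutExpansion F R))
           (k : ℕ) (A : Structure L) (A∈Age : A ∈ Age F)
           (B* : Structure (L ⊕ E)) (B*∈Age : B* ∈ Age (expand F R)) where

    private
      module F  = Fraïssé fraïssé
      module F* = Fraïssé fraïssé*
      module A  = Inverse (proj₂ (proj₁ A∈Age))
      module B  = Inverse (proj₂ (proj₁ B*∈Age))
      open Embedding using (to)

      B : Structure L
      B = reduct B*

      a₀ : Embedding A F
      a₀ = proj₂ A∈Age

      Colorings : Set
      Colorings = Coloring {Embeddings A F} {k}

      -- Composition with b makes c constant on the embeddings of A in B that
      -- induce the same expansion.
      Good : Embedding B F → Pred Colorings 0ℓ
      Good b c = Monochromatic {E = E} B* c b

      -- No embedding of B in F is good for c.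
      Bad : Pred Colorings 0ℓ
      Bad c = ∀ b → ¬ Good b c

      -- The composites of b with the functions from A to B, which are indexed by codes.
      candidate : Embedding B F → Fin (proj₁ (proj₁ B*∈Age) ℕ.^ proj₁ (proj₁ A∈Age)) →
                  Carrier A → Carrier F
      candidate b code x = to b (B.from (Fin.finToFun code (A.to x)))

      -- Every embedding of the form b ∘ₑ a equals one in this list pointwise, so the
      -- list contains all indices on which goodness of b depends.
      support : Embedding B F → List (Embedding A F)
      support b = List.tabulate (pick a₀ ∘ candidate b)

      agree-∘ : ∀ b {c d : Colorings} → AgreeAt {Embeddings A F} {k} (support b) c d →
                ∀ (a : Embedding A B) → Func.to c (b ∘ₑ a) ≡ Func.to d (b ∘ₑ a)
      agree-∘ b {c} {d} agree a = begin
        Func.to c (b ∘ₑ a)                      ≡⟨ Func.cong c picked ⟨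
        Func.to c (pick a₀ (candidate b code))  ≡⟨ All.tabulate⁻ agree code ⟩
        Func.to d (pick a₀ (candidate b code))  ≡⟨ Func.cong d picked ⟩
        Func.to d (b ∘ₑ a)                      ∎
        where
        open ≡-Reasoning
        f : Fin (proj₁ (proj₁ A∈Age)) → Fin (proj₁ (proj₁ B*∈Age))
        f i = B.to (to a (A.from i))
        code = Fin.funToFin f
        picked : ∀ x → to (pick a₀ (candidate b code)) x ≡ to b (to a x)
        picked = pick-≈ a₀ (candidate b code) (b ∘ₑ a) λ x → sym (cong (to b) (begin
          B.from (Fin.finToFun code (A.to x))  ≡⟨ cong B.from (finToFun-funToFin f (A.to x)) ⟩
          B.from (B.to (to a (A.from (A.to x)))) ≡⟨ B.strictlyInverseʳ _ ⟩
          to a (A.from (A.to x))               ≡⟨ cong (to a) (A.strictlyInverseʳ x) ⟩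
          to a x                               ∎))

      good-open : ∀ b {c} → c ∈ Good b → c ∈ Interior {Embeddings A F} {k} (Good b)
      good-open b {c} good = support b , λ d agree a a′ same →
        trans (sym (agree-∘ b {c} {d} agree a))
          (trans (good a a′ same) (agree-∘ b {c} {d} agree a′))

      open ColoringSpace {Embeddings A F} {k} Bad ℓ

      -- The embedding g⁻¹ ∘ a.  Automorphisms act on colorings by
      -- (g · c)(a) = c(g⁻¹ ∘ a).
      _⁻¹·ₑ_ : {D : Structure L} → Automorphism F → Embedding D F → Embedding D F
      g ⁻¹·ₑ a = asEmbedding (isomorphism-sym g) ∘ₑ a

      act : Automorphism F → Point → Point
      act g (point c bad) = point
        (record { to   = λ a → Func.to c (g ⁻¹·ₑ a)
                ; cong = λ a≈a′ → Func.cong c (λ x → cong (Isomorphism.from g) (a≈a′ x)) })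
        λ b good → bad (g ⁻¹·ₑ b) λ a a′ same →
          trans (Func.cong c (λ _ → refl)) (trans (good a a′ same) (Func.cong c (λ _ → refl)))

      action : ContinuousAction {ℓ₂ = ℓ} (Aut F) topology
      action = record
        { _·_        = act
        ; ·-cong     = λ {g} {h} {p} {q} g≈h (lift p≈q) → lift λ a → trans
            (Func.cong (coloring p) (λ x →
              TopologicalGroup.⁻¹-cong (Aut F) {g} {h} g≈h (to a x)))
            (p≈q (h ⁻¹·ₑ a))
        ; identity   = λ p → lift λ a → Func.cong (coloring p) (λ _ → refl)
        ; compatible = λ g h p → lift λ a → Func.cong (coloring p) (λ _ → refl)
        ; continuous = λ V (lift V-open) {(g , p)} gp∈V →
            let (as , near) = V-open (act g p) gp∈V
                xs = List.concat (List.map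
                  (λ a → List.tabulate (λ i → to (g ⁻¹·ₑ a) (A.from i))) as)
            in AgreeOn F xs g ,
               (λ q → Lift ℓ (Near (List.map (g ⁻¹·ₑ_) as) p q)) ,
               lift (λ h g-h → xs , λ h′ h-h′ →
                 All.zipWith (λ (eq , eq′) → trans eq eq′) (g-h , h-h′)) ,
               near-open _ p ,
               (All.universal (λ _ → refl) xs , lift (All.universal (λ _ → refl) _)) ,
               λ { {h , q} (g-h , lift p-q) → near (act h q) (moved g h p q as g-h p-q) }
        }
        where
        -- If h agrees with g at the points g⁻¹(a(x)), then the inverses of g and h agree
        -- at the values a(x).
        moved : ∀ g h p q as →
                AgreeOn F (List.concat (List.map
                  (λ a → List.tabulate (λ i → to (g ⁻¹·ₑ a) (A.from i))) as)) g h →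
                Near (List.map (g ⁻¹·ₑ_) as) p q →
                Near as (act g p) (act h q)
        moved g h p q []       _   _          = []
        moved g h p q (a ∷ as) g-h (eq ∷ p-q) =
          trans eq (Func.cong (coloring q) same) ∷ moved g h p q as (All.++⁻ʳ _ g-h) p-q
          where
          module g = Isomorphism g
          module h = Isomorphism h
          same : ∀ x → g.from (to a x) ≡ h.from (to a x)
          same x = h.injective (begin
            h.to (g.from (to a x))
              ≡⟨ cong (h.to ∘ g.from ∘ to a) (A.strictlyInverseʳ x) ⟨
            h.to (g.from (to a (A.from (A.to x))))
              ≡⟨ All.tabulate⁻ (All.++⁻ˡ (List.tabulate _) g-h) (A.to x) ⟨
            g.to (g.from (to a (A.from (A.to x))))
              ≡⟨ g.strictlyInverseˡ _ ⟩
            to a (A.from (A.to x))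
              ≡⟨ cong (to a) (A.strictlyInverseʳ x) ⟩
            to a x
              ≡⟨ h.strictlyInverseˡ _ ⟨
            h.to (h.from (to a x)) ∎)
            where open ≡-Reasoning

      enum : ℕ → Embedding A F
      enum = embeddings (proj₁ A∈Age) F.countablyInfinite a₀

      enum-onto : ∀ a → ∃[ n ] Setoid._≈_ (Embeddings A F) (enum n) a
      enum-onto = embeddings-onto (proj₁ A∈Age) F.countablyInfinite a₀

      -- The embedding of B* in F* is good for a G*-invariant coloring.
      no-fixed-point : (p : Point) →
        ¬ (∀ h → h ∈ Subgroup.Member (AutExpansion F R) → Setoid._≈_ points (act h p) p)
      no-fixed-point p fixed = member p b good
        where
        c = coloring p
        b* : Embedding B* (expand F R)
        b* = proj₂ B*∈Age
        b : Embedding B F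
        b = reductEmbedding b*
        good : Good b c
        good a a′ same = trans
          (Func.cong c (λ x → trans (sym (strictlyInverseʳ _)) (cong from (moves x))))
          (lower (fixed (reductAutomorphism g) (g , λ _ → refl)) (b ∘ₑ a′))
          where
          -- Both composites embed in F* the expansion of A induced by a.
          extension = extend F*.ultrahomogeneous (proj₁ A∈Age)
            (b* ∘ₑ expandEmbedding {S = inducedRelations B* a} a (λ i v → ⇔-id _))
            (b* ∘ₑ expandEmbedding a′ same)
          g = proj₁ extension
          moves = proj₂ extension
          open Isomorphism g using (from; strictlyInverseʳ)

      no-bad : ∀ c → ¬ Bad c
      no-bad c bad =
        let (p , fixed) = amenable points topology (point c bad) hausdorff
              (compact enum enum-onto Good good-open (λ bad → bad) (λ bad → bad)) action
        in no-fixed-point p fixed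

      cover : ∃[ bs ] ∀ c → Any (λ b → c ∈ Good b) bs
      cover = finiteSubcover {Embeddings A F} {k} enum enum-onto Good λ c → some c
        where
        some : ∀ c → ∃[ b ] c ∈ Interior {Embeddings A F} {k} (Good b)
        some c with em {P = ∃[ b ] c ∈ Good b}
        ... | yes (b , good) = b , good-open b {c} good
        ... | no ¬good       = contradiction (λ b good → ¬good (b , good)) (no-bad c)

      bs = proj₁ cover

      values : Embedding B F → List (Carrier F)
      values b = List.tabulate (to b ∘ B.from)

      -- The image of a₀ is included so that A embeds in C, which supplies a
      -- default color in extended below.
      generators : List (Carrier F)
      generators = List.tabulate (to a₀ ∘ A.from) ++ List.concatMap values bs

      S : Substructure F
      S = ⟨ generators ⟩

      C : Structure L
      C = structure S

      a₀∈S : ∀ x → Member S (to a₀ x)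
      a₀∈S x = generator (Any.++⁺ˡ (Any.tabulate⁺ (A.to x)
        (cong (to a₀) (sym (A.strictlyInverseʳ x)))))

      b∈S : ∀ {b} → b ∈ₗ bs → ∀ x → Member S (to b x)
      b∈S {b} b∈bs x = generator (Any.++⁺ʳ _ (Any.concatMap⁺ values (Any.map
        (λ { refl → Any.tabulate⁺ (B.to x) (cong (to b) (sym (B.strictlyInverseʳ x))) }) b∈bs)))

      -- A coloring of the embeddings in C, extended to those in F.
      module _ (c : Func (Embeddings A C) (setoid (Fin k))) where

        -- The embedding a in F takes values in C and restricts to d.
        Restricts : Embedding A C → Embedding A F → Set
        Restricts d a = ∀ x → value (to d x) ≡ to a x

        -- The color of the restriction, or a default color if a leaves C.
        extended : (a : Embedding A F) → Dec (∃[ d ] Restricts d a) → Fin k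
        extended a (yes (d , _)) = Func.to c d
        extended a (no _)        = Func.to c (corestrict S a₀ (λ x → [ a₀∈S x ]))

        extended-≡ : ∀ a d → Restricts d a → (dec : Dec (∃[ d ] Restricts d a)) →
                     extended a dec ≡ Func.to c d
        extended-≡ a d d-a (yes (d′ , d′-a)) =
          Func.cong c (λ x → value-injective (trans (d′-a x) (sym (d-a x))))
        extended-≡ a d d-a (no ¬d)           = contradiction (d , d-a) ¬d

        extended-cong : ∀ {a a′} → (∀ x → to a x ≡ to a′ x) →
                        (dec : Dec (∃[ d ] Restricts d a))
                        (dec′ : Dec (∃[ d ] Restricts d a′)) →
                        extended a dec ≡ extended a′ dec′
        extended-cong a≈a′ (yes (d , d-a)) dec′ =
          sym (extended-≡ _ d (λ x → trans (d-a x) (a≈a′ x)) dec′)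
        extended-cong a≈a′ (no ¬d) (yes (d , d-a′)) =
          contradiction (d , λ x → trans (d-a′ x) (sym (a≈a′ x))) ¬d
        extended-cong a≈a′ (no _) (no _) = refl

        extension : Colorings
        extension = record
          { to   = λ a → extended a em
          ; cong = λ {a} {a′} a≈a′ → extended-cong {a} {a′} a≈a′ em em
          }

        -- Good embeddings for the extended coloring restrict to C.
        restricted : ∃[ b ] b ∈ₗ bs × Good b extension →
                     Σ[ b ∈ Embedding B C ] Monochromatic {E = E} B* c b
        restricted (b , b∈bs , good) = b′ , λ a a′ same →
          trans (sym (extended-≡ (b ∘ₑ a) (b′ ∘ₑ a) (λ _ → refl) em))
          (trans (good a a′ same) (extended-≡ (b ∘ₑ a′) (b′ ∘ₑ a′) (λ _ → refl) em))
          where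
          b′ : Embedding B C
          b′ = corestrict S b (λ x → [ b∈S b∈bs x ])

    amenable⇒ramsey : Σ[ C ∈ Structure L ] C ∈ Age F ×
      ((c : Func (Embeddings A C) (setoid (Fin k))) →
       Σ[ b ∈ Embedding (reduct B*) C ] Monochromatic {E = E} B* c b)
    amenable⇒ramsey =
      C , (F.locallyFinite generators , inclusion S) , λ c →
      restricted c (find (proj₂ cover (extension c)))

  ----------------------------------------------------------------------
  -- The Ramsey property implies relative extreme amenability

  -- The least element of an inhabited subset of Fin n.  Unlike an arbitrary choice of
  -- witness, it depends only on the subset (least-cong).
  least : ∀ {p n} {P : Pred (Fin n) p} → ∃ P → Fin n
  least {n = suc n} {P} (i , p) with em {P = P Fin.zero}
  ... | yes _ = Fin.zero
  least {n = suc n} (Fin.zero  , p) | no ¬p = contradiction p ¬p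
  least {n = suc n} {P} (Fin.suc i , p) | no ¬p = Fin.suc (least {P = P ∘ Fin.suc} (i , p))

  least-∈ : ∀ {p n} {P : Pred (Fin n) p} (w : ∃ P) → least {P = P} w ∈ P
  least-∈ {n = suc n} {P} (i , p) with em {P = P Fin.zero}
  ... | yes p₀ = p₀
  least-∈ {n = suc n} (Fin.zero  , p) | no ¬p = contradiction p ¬p
  least-∈ {n = suc n} {P} (Fin.suc i , p) | no ¬p = least-∈ {P = P ∘ Fin.suc} (i , p)

  least-cong : ∀ {p n} {P Q : Pred (Fin n) p} → P ≐ Q → (v : ∃ P) (w : ∃ Q) →
               least {P = P} v ≡ least {P = Q} w
  least-cong {n = suc n} {P} {Q} (P⊆Q , Q⊆P) (i , p) (j , q)
    with em {P = P Fin.zero} | em {P = Q Fin.zero}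
  ... | yes _  | yes _  = refl
  ... | yes p₀ | no ¬q  = contradiction (P⊆Q p₀) ¬q
  ... | no ¬p  | yes q₀ = contradiction (Q⊆P q₀) ¬p
  least-cong (P⊆Q , Q⊆P) (Fin.zero , p) _ | no ¬p | no ¬q = contradiction p ¬p
  least-cong (P⊆Q , Q⊆P) (Fin.suc i , p) (Fin.zero , q) | no ¬p | no ¬q = contradiction q ¬q
  least-cong {P = P} {Q} (P⊆Q , Q⊆P) (Fin.suc i , p) (Fin.suc j , q) | no ¬p | no ¬q =
    cong Fin.suc (least-cong {P = P ∘ Fin.suc} {Q ∘ Fin.suc} (P⊆Q , Q⊆P) (i , p) (j , q))

  module _ {L : Signature} {E : RelationalSignature} {F : Structure L} (fraïssé : Fraïssé F)
           {R : NewRelations {L} {E} F} (fraïssé* : Fraïssé (expand F R))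
           (ramsey : RelativeRamsey (Age F) (Age (expand F R)))
           {ℓ : Level} {X : Setoid ℓ ℓ} {τ : Topology X} (x₀ : Setoid.Carrier X)
           (hausdorff : Hausdorff τ) (compact : Compact τ)
           (action : ContinuousAction {ℓ₂ = ℓ} (Aut F) τ) where

    private
      module F  = Fraïssé fraïssé
      module F* = Fraïssé fraïssé*
      module X  = Setoid X
      open ContinuousAction action
      open Topology τ using (IsOpen; open-respects; intersection-open)
      open Isomorphism using (to; from; strictlyInverseʳ; strictlyInverseˡ)
      open TopologicalGroup (Aut F) using (ε)
        renaming (_∙_ to infixl 8 _∙_; _⁻¹ to infix 9 _⁻¹; Carrier to G)
      H : Pred G 0ℓ
      H = Subgroup.Member (AutExpansion F R)

      -- Continuity of the action at (g , x), in terms of basic neighbourhoods of g.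
      nearby : ∀ {V} → IsOpen V → ∀ g x → g · x ∈ V →
               ∃[ xs ] Σ[ W ∈ Pred X.Carrier ℓ ] IsOpen W × x ∈ W ×
                 (∀ h {y} → AgreeOn F xs g h → y ∈ W → h · y ∈ V)
      nearby {V} V-open g x gx∈V =
        let (N , W , N-open , W-open , (g∈N , x∈W) , N×W⊆) = continuous V V-open {g , x} gx∈V
            (xs , near) = lower N-open g g∈N
        in xs , W , W-open , x∈W , λ h {y} agree y∈W → N×W⊆ {h , y} (near h agree , y∈W)

      -- The translate of V by h is disjoint from V.
      Displaced : Pred X.Carrier ℓ → G → Set ℓ
      Displaced V h = ∀ {x} → x ∈ V → ¬ (h · x ∈ V)

      displacement : ∀ {h x} → ¬ (h · x X.≈ x) → ∃[ V ] IsOpen V × x ∈ V × Displaced V h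
      displacement {h} {x} hx≉x =
        let (V , W , V-open , W-open , hx∈V , x∈W , V⊥W) = hausdorff (h · x) x hx≉x
            (_ , W′ , W′-open , x∈W′ , near) = nearby V-open h x hx∈V
        in (λ y → W y × W′ y) , intersection-open W-open W′-open , (x∈W , x∈W′) ,
           λ (y∈W , y∈W′) (hy∈W , _) → V⊥W (near h (All.universal (λ _ → refl) _) y∈W′ , hy∈W)

      module _ (unfixed : ¬ (∃[ x ] ∀ h → h ∈ H → h · x X.≈ x)) where

        moves : ∀ x → ∃[ h ] h ∈ H × ¬ (h · x X.≈ x)
        moves x with em {P = ∃[ h ] h ∈ H × ¬ (h · x X.≈ x)}
        ... | yes found = found
        ... | no ¬found = contradiction (x , fixes) unfixed
          where
          fixes : ∀ h → h ∈ H → h · x X.≈ x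
          fixes h h∈H with em {P = h · x X.≈ x}
          ... | yes hx≈x = hx≈x
          ... | no hx≉x  = contradiction (h , h∈H , hx≉x) ¬found

        -- The open sets displaced off themselves by some element of H.
        𝒰 : Pred (Pred X.Carrier ℓ) (Level.suc ℓ)
        𝒰 V = IsOpen V × ∃[ h ] h ∈ H × Displaced V h

        𝒰-subcover : ∃[ Vs ] All 𝒰 Vs × (∀ x → Any (x ∈_) Vs)
        𝒰-subcover = compact 𝒰 proj₁ λ x →
          let (h , h∈H , hx≉x) = moves x
              (V , V-open , x∈V , displaced) = displacement hx≉x
          in V , (V-open , h , h∈H , displaced) , x∈V

        Vs = proj₁ 𝒰-subcover
        Index = Fin (List.length Vs)

        V : Index → Pred X.Carrier ℓ
        V = List.lookup Vs

        V∈𝒰 : ∀ i → V i ∈ 𝒰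
        V∈𝒰 i = All.lookup (proj₁ (proj₂ 𝒰-subcover)) (∈-lookup i)

        -- An element of H that displaces V i.
        mover : Index → G
        mover i = proj₁ (proj₂ (V∈𝒰 i))

        mover* : ∀ i → mover i ∈ H
        mover* i = proj₁ (proj₂ (proj₂ (V∈𝒰 i)))

        V-covers : ∀ x → ∃[ i ] x ∈ V i
        V-covers x = Any.index any , Any.lookup-index any
          where any = proj₂ (proj₂ 𝒰-subcover) x

        -- The open sets W for which the elements fixing some finite list of
        -- points all map W into the same V i.
        𝒲 : Pred (Pred X.Carrier ℓ) (Level.suc ℓ)
        𝒲 W = IsOpen W × ∃[ xs ] ∃[ i ] (∀ h {y} → AgreeOn F xs ε h → y ∈ W → h · y ∈ V i)

        𝒲-subcover : ∃[ Ws ] All 𝒲 Ws × (∀ x → Any (x ∈_) Ws)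
        𝒲-subcover = compact 𝒲 proj₁ λ x →
          let (i , x∈V) = V-covers x
              (xs , W , W-open , x∈W , near) = nearby (proj₁ (V∈𝒰 i)) ε x
                (open-respects (proj₁ (V∈𝒰 i)) (X.sym (identity x)) x∈V)
          in W , (W-open , xs , i , near) , x∈W

        -- Concatenating the lists for a finite cover gives one list that works
        -- for all points.
        gather : ∀ {Ws} → All 𝒲 Ws → ∃[ xs ] ∀ {y} → Any (y ∈_) Ws →
                 ∃[ i ] ∀ h → AgreeOn F xs ε h → h · y ∈ V i
        gather [] = [] , λ ()
        gather ((_ , xs , i , near) ∷ Ws⊆𝒲) =
          let (ys , rest) = gather Ws⊆𝒲 in xs ++ ys , λ
          { (here y∈W)  → i , λ h agree → near h (All.++⁻ˡ xs agree) y∈W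
          ; (there any) → let (j , near′) = rest any in j , λ h agree → near′ h (All.++⁻ʳ xs agree)
          }

        xs : List (Carrier F)
        xs = proj₁ (gather (proj₁ (proj₂ 𝒲-subcover)))

        -- The orbit of y under the stabilizer of xs lies in a single V i.
        localized : ∀ y → ∃[ i ] ∀ h → AgreeOn F xs ε h → h · y ∈ V i
        localized y = proj₂ (gather (proj₁ (proj₂ 𝒲-subcover))) (proj₂ (proj₂ 𝒲-subcover) y)

        S : Substructure F
        S = ⟨ xs ⟩

        A : Structure L
        A = structure S

        A∈Age : A ∈ Age F
        A∈Age = F.locallyFinite xs , inclusion S

        -- The color i is admissible for a if every automorphism g extending a
        -- has g⁻¹ x₀ in V i.
        Captures : Embedding A F → Pred Index ℓ
        Captures a i = ∀ g → (∀ x → to g (value x) ≡ Embedding.to a x) → g ⁻¹ · x₀ ∈ V i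

        -- Two automorphisms g₀ and g that extend a differ by an element fixing xs, so
        -- g⁻¹ x₀ is in the orbit of g₀⁻¹ x₀ under the stabilizer of xs.
        captures : ∀ a → ∃[ i ] Captures a i
        captures a = i , λ g g-a →
          open-respects (proj₁ (V∈𝒰 i))
            (X.trans (X.sym (compatible (g ⁻¹ ∙ g₀) (g₀ ⁻¹) x₀))
              (·-cong {(g ⁻¹ ∙ g₀) ∙ g₀ ⁻¹} {g ⁻¹}
                (λ x → cong (from g) (strictlyInverseˡ g₀ x)) X.refl))
            (near (g ⁻¹ ∙ g₀) (All.tabulate (λ {x} x∈xs → sym (trans
              (cong (from g) (trans (g₀-a (x , [ generator x∈xs ])) (sym (g-a _))))
              (strictlyInverseʳ g x)))))
          where
          g₀ : G
          g₀ = proj₁ (extend F.ultrahomogeneous (proj₁ A∈Age) (inclusion S) a)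
          g₀-a = proj₂ (extend F.ultrahomogeneous (proj₁ A∈Age) (inclusion S) a)
          i = proj₁ (localized (g₀ ⁻¹ · x₀))
          near = proj₂ (localized (g₀ ⁻¹ · x₀))

        captures-cong : ∀ {a a′} → (∀ x → Embedding.to a x ≡ Embedding.to a′ x) →
                        Captures a ≐ Captures a′
        captures-cong a≈a′ =
          (λ capt g g-a′ → capt g (λ x → trans (g-a′ x) (sym (a≈a′ x)))) ,
          (λ capt g g-a → capt g (λ x → trans (g-a x) (a≈a′ x)))

        -- Kept abstract so that comparing colors never unfolds the search.
        abstract
          color : Embedding A F → Index
          color a = least (captures a)

          color-captures : ∀ a → color a ∈ Captures a
          color-captures a = least-∈ (captures a)

          color-cong : ∀ {a a′} → (∀ x → Embedding.to a x ≡ Embedding.to a′ x) →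
                       color a ≡ color a′
          color-cong {a} {a′} a≈a′ =
            least-cong (captures-cong {a} {a′} a≈a′) (captures a) (captures a′)

        -- The points of xs and their translates by the chosen elements of H.
        ys : List (Carrier F)
        ys = xs ++ List.concat (List.tabulate λ i → List.map (to (mover i)) xs)

        S* : Substructure (expand F R)
        S* = ⟨ ys ⟩

        B* : Structure (L ⊕ E)
        B* = structure S*

        B*∈Age : B* ∈ Age (expand F R)
        B*∈Age = F*.locallyFinite ys , inclusion S*

        B : Structure L
        B = reduct B*

        -- The structure on this substructure is definitionally B.
        S*-reduct : Substructure F
        S*-reduct = record { Member = Member S* ; closed = closed S* }

        module _ (g : G) (g-xs : ∀ {x} → x ∈ₗ xs → to g x ∈ₗ ys) where

          mutual
            transported : ∀ {x} → Generated F xs x → Generated (expand F R) ys (to g x)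
            transported (generator x∈xs) = generator (g-xs x∈xs)
            transported (apply f v ps)   = subst (Generated (expand F R) ys)
              (sym (Isomorphism.fun-homo g f v)) (apply f (Vec.map (to g) v) (transportedAll ps))

            transportedAll : ∀ {n} {v : Vec (Carrier F) n} → VecAll.All (Generated F xs) v →
                             VecAll.All (Generated (expand F R) ys) (Vec.map (to g) v)
            transportedAll []       = []
            transportedAll (p ∷ ps) = transported p ∷ transportedAll ps

          -- The restriction of g to A, as an embedding in B.
          translate : Embedding A B
          translate = corestrict S*-reduct (asEmbedding g ∘ₑ inclusion S)
            λ { (x , [ p ]) → [ transported p ] }

        a₀ : Embedding A B
        a₀ = translate ε Any.++⁺ˡ

        a : Index → Embedding A B
        a i = translate (mover i) λ x∈xs →
          Any.++⁺ʳ xs (Any.concat⁺ (Any.tabulate⁺ i (∈-map⁺ (to (mover i)) x∈xs)))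

        -- The elements of H preserve the relations R.
        same : ∀ i → SameInducedExpansion B* a₀ (a i)
        same i s v = subst₂ (λ u w → R s u ⇔ R s w) (sym eq₀) (sym eq)
          (Isomorphism.rel-iff h* (inj₂ s) (Vec.map value v))
          where
          h* = proj₁ (mover* i)
          eq₀ : Vec.map value (Vec.map (Embedding.to a₀) v) ≡ Vec.map value v
          eq₀ = sym (map-∘ value (Embedding.to a₀) v)
          eq : Vec.map value (Vec.map (Embedding.to (a i)) v) ≡ Vec.map (to h*) (Vec.map value v)
          eq = begin
            Vec.map value (Vec.map (Embedding.to (a i)) v)
              ≡⟨ map-∘ value (Embedding.to (a i)) v ⟨
            Vec.map (to (mover i) ∘ value) v
              ≡⟨ map-cong (λ x → proj₂ (mover* i) (value x)) v ⟨
            Vec.map (to h* ∘ value) v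
              ≡⟨ map-∘ (to h*) value v ⟩
            Vec.map (to h*) (Vec.map value v) ∎
            where open ≡-Reasoning

        -- No embedding b gives the inclusion of A and its translate by mover i the common
        -- color i: for g extending b, the point (g ∙ h)⁻¹ x₀ and its image g⁻¹ x₀ under
        -- h = mover i would both be in V i, which h displaces.
        not-both-captured : (b : Embedding B F) (i : Index) →
                            Captures (b ∘ₑ a₀) i → ¬ Captures (b ∘ₑ a i) i
        not-both-captured b i capt₀ capt =
          displaced y∈V (open-respects (proj₁ (V∈𝒰 i)) (X.sym hy≈z) z∈V)
          where
          h : G
          h = mover i
          displaced : Displaced (V i) h
          displaced = proj₂ (proj₂ (proj₂ (V∈𝒰 i)))
          extension = extend F.ultrahomogeneous (proj₁ B*∈Age) (inclusion S*-reduct) b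
          g : G
          g = proj₁ extension
          z∈V : g ⁻¹ · x₀ ∈ V i
          z∈V = capt₀ g λ x → proj₂ extension (Embedding.to a₀ x)
          y∈V : (g ∙ h) ⁻¹ · x₀ ∈ V i
          y∈V = capt (g ∙ h) λ x → proj₂ extension (Embedding.to (a i) x)
          hy≈z : h · (g ∙ h) ⁻¹ · x₀ X.≈ g ⁻¹ · x₀
          hy≈z = X.trans (X.sym (compatible h ((g ∙ h) ⁻¹) x₀))
            (·-cong {h ∙ (g ∙ h) ⁻¹} {g ⁻¹} (λ x → strictlyInverseˡ h _) X.refl)

        unfixed⇒⊥ : ⊥
        unfixed⇒⊥ = not-both-captured (κ ∘ₑ b) i
          (color-captures (κ ∘ₑ (b ∘ₑ a₀)))
          (subst (Captures (κ ∘ₑ (b ∘ₑ a i))) (sym (mono a₀ (a i) (same i)))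
            (color-captures (κ ∘ₑ (b ∘ₑ a i))))
          where
          statement = ramsey (List.length Vs) A A∈Age B* B*∈Age
          C : Structure L
          C = proj₁ statement
          κ : Embedding C F
          κ = proj₂ (proj₁ (proj₂ statement))
          c : Func (Embeddings A C) (setoid Index)
          c = record
            { to   = λ d → color (κ ∘ₑ d)
            ; cong = λ d≈d′ → color-cong (λ x → cong (Embedding.to κ) (d≈d′ x))
            }
          homogeneous = proj₂ (proj₂ statement) c
          b : Embedding B C
          b = proj₁ homogeneous
          mono : ∀ d d′ → SameInducedExpansion B* d d′ →
                 color (κ ∘ₑ (b ∘ₑ d)) ≡ color (κ ∘ₑ (b ∘ₑ d′))
          mono = proj₂ homogeneous
          i : Index
          i = color (κ ∘ₑ (b ∘ₑ a₀))

    ramsey⇒fixed : ∃[ x ] ∀ h → h ∈ Subgroup.Member (AutExpansion F R) → h · x X.≈ x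
    ramsey⇒fixed with em {P = ∃[ x ] ∀ h → h ∈ H → h · x X.≈ x}
    ... | yes fixed  = fixed
    ... | no unfixed = ⊥-elim (unfixed⇒⊥ unfixed)

------------------------------------------------------------------------
-- The equivalence

theorem2 : (∀ {a} → ExcludedMiddle a) →
    (L : Signature) → CountableSignature L →
    (E : RelationalSignature) → Countable (RelationalSignature.Symbol E) →
    (F : Structure L) → Fraïssé F →
    (R : NewRelations {L} {E} F) → Fraïssé (expand F R) →
    Precompact F R →
    ∀ ℓ →
    RelativelyExtremelyAmenable ℓ (Aut F) (AutExpansion F R)
    ⇔
    ((∀ A* → A* ∈ Age (expand F R) → Rigid A*) ×
    RelativeRamsey (Age F) (Age (expand F R)))
theorem2 em L _ E _ F fraïssé R fraïssé* _ ℓ = mk⇔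
  (λ amenable →
    let ramsey = amenable⇒ramsey fraïssé fraïssé* amenable
    in ramsey⇒rigid {F = F} ramsey , ramsey)
  (λ (_ , ramsey) X τ x₀ hausdorff compact action →
    ramsey⇒fixed fraïssé fraïssé* ramsey x₀ hausdorff compact action)
  where open Classical em
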